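{- For every odd positive integer $n$, the only regular Steinhaus graph on $n$ vertices whose Steinhaus matrix is multi-symmetric is the zero-edge graph on $n$ vertices.
   Context: A Steinhaus matrix of size $n\geq1$ is a matrix $M=(a_{i,j})_{1\leq i,j\leq n}$ with entries in $\mathbb{F}_2=\{0,1\}$ such that $a_{i,i}=0$ for all $i$, $a_{i,j}=a_{i-1,j-1}+a_{i-1,j}$ (addition in $\mathbb{F}_2$) for all $2\leq i<j\leq n$, and $a_{i,j}=a_{j,i}$ for all $i,j$. A Steinhaus graph is a simple graph on labelled vertices $V_1,\ldots,V_n$ whose adjacency matrix is a Steinhaus matrix (its Steinhaus matrix). A square matrix $(a_{i,j})$ of size $n$ is doubly-symmetric if $a_{i,j}=a_{j,i}=a_{n-j+1,n-i+1}$ for all $i,j$; it is multi-symmetric if it is doubly-symmetric and $a_{i,j}=a_{i,n-j+i+1}$ for all $1\leq i<j\leq n$. -}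

module Defs where

open import Data.Nat using (ℕ; zero; suc; _+_; _∸_; _<_; _≤_; _<?_)
open import Data.Bool using (Bool; true; false; _xor_)
open import Data.Fin using (Fin; toℕ; fromℕ<)
open import Data.List using (List; length; filter)
open import Data.Fin.Base using () 
open import Data.List.Base using () renaming (allFin to allFinL)
open import Relation.Binary.PropositionalEquality using (_≡_)
open import Relation.Nullary using (yes; no)

-- A square matrix of size n with entries in F₂ = Bool (addition = xor).
-- Indices are 0-based: the paper's a_{i,j} (1 ≤ i,j ≤ n) is  M (i-1) (j-1).
Matrix : ℕ → Set
Matrix n = Fin n → Fin n → Bool

-- Entry at natural-number (0-based) indices; only ever used with i , j < n
-- (all uses below carry those bounds as hypotheses).
entry : ∀ {n} → Matrix n → ℕ → ℕ → Bool
entry {n} M i j with i <? n | j <? n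
... | yes i<n | yes j<n = M (fromℕ< i<n) (fromℕ< j<n)
... | _       | _       = false

-- Steinhaus matrix: zero diagonal, local rule a_{i,j} = a_{i-1,j-1} + a_{i-1,j}
-- for 2 ≤ i < j ≤ n (1-based), i.e. for 1 ≤ i < j ≤ n-1 (0-based), symmetric.
record IsSteinhaus {n : ℕ} (M : Matrix n) : Set where
  field
    diag-zero  : ∀ (i : Fin n) → M i i ≡ false
    local-rule : ∀ (i j : ℕ) → suc i < j → j < n →
                 entry M (suc i) j ≡ (entry M i (j ∸ 1) xor entry M i j)
    symmetric  : ∀ (i j : Fin n) → M i j ≡ M j i

-- Doubly-symmetric: a_{i,j} = a_{j,i} = a_{n-j+1,n-i+1} (1-based),
-- i.e. a i j = a j i = a (n-1-j) (n-1-i) (0-based).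
record IsDoublySymmetric {n : ℕ} (M : Matrix n) : Set where
  field
    sym     : ∀ (i j : Fin n) → M i j ≡ M j i
    antisym : ∀ (i j : ℕ) → i < n → j < n →
              entry M i j ≡ entry M (n ∸ 1 ∸ j) (n ∸ 1 ∸ i)

-- Multi-symmetric: doubly-symmetric and a_{i,j} = a_{i,n-j+i+1} for 1 ≤ i < j ≤ n
-- (1-based), i.e. a i j = a i (n-j+i) for 0 ≤ i < j ≤ n-1 (0-based).
record IsMultiSymmetric {n : ℕ} (M : Matrix n) : Set where
  field
    doubly : IsDoublySymmetric M
    multi  : ∀ (i j : ℕ) → i < j → j < n →
             entry M i j ≡ entry M i (n ∸ j + i)

degree : ∀ {n} → Matrix n → Fin n → ℕ
degree {n} M i = length (filter (λ j → M i j Data.Bool.≟ true) (allFinL n))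

IsRegular : ∀ {n} → Matrix n → Set
IsRegular {n} M = ∀ (i j : Fin n) → degree M i ≡ degree M j

IsZero : ∀ {n} → Matrix n → Set
IsZero {n} M = ∀ (i j : Fin n) → M i j ≡ false

-- Write the strict upper triangle of M as T r t = a_{r, r+t+1} (0-based), with m = n - 1
-- even, and let R r be the integer sum of its row r. Multi-symmetry makes every row a
-- palindrome and gives vertex p the degree R p + R (m - p). For even 0 < p < m both rows have even
-- length, so half the degree is a sum of two half rows, whose parities telescope; the
-- parity of half the common degree d is then T 1 t for every odd t. The symmetry
-- T 1 3 = T 3 1 (for n = 5, the palindrome of row 0) forces this constant to be 0. Hence row 2 repeats the even entries of
-- row 1, so R 2 + 2 (T 1 0) = 2 (R 1), while the degrees of vertices 1 and 2 read
-- d = R 1 + T 0 0 = R 2 + T 1 0 + T 0 1. As d = R 0 is even, d = 0.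
module Submission where

open import Defs
open import Data.Bool using (Bool; true; false; not; _xor_; _≟_)
open import Data.Bool.Properties using (xor-same; xor-assoc; xor-identityʳ)
open import Data.Fin using (Fin; zero; suc; toℕ; fromℕ<)
open import Data.Fin.Properties using (toℕ<n; fromℕ<-toℕ; toℕ-fromℕ<)
open import Data.List using (length; filter; tabulate)
open import Data.Nat using (ℕ; zero; suc; _+_; _*_; _∸_; _<_; _≤_; _<?_; z≤n; s≤s; ⌊_/2⌋)
open import Data.Nat.Properties hiding (_≟_)
open import Data.Nat.Tactic.RingSolver using (solve-∀)
open import Data.Product using (_,_)
open import Function using (_∘_; id)
open import Relation.Binary.Definitions using (tri<; tri≈; tri>)
open import Relation.Binary.PropositionalEquality
open import Relation.Nullary using (yes; no; contradiction)

-- Counting true values and their parity.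

bit : Bool → ℕ
bit false = 0
bit true  = 1

count : (ℕ → Bool) → ℕ → ℕ
count f zero    = 0
count f (suc n) = bit (f 0) + count (f ∘ suc) n

odd : ℕ → Bool
odd zero    = false
odd (suc n) = not (odd n)

count-cong : ∀ {f g} n → (∀ i → i < n → f i ≡ g i) → count f n ≡ count g n
count-cong zero    e = refl
count-cong (suc n) e =
  cong₂ _+_ (cong bit (e 0 (s≤s z≤n))) (count-cong n (λ i i<n → e (suc i) (s≤s i<n)))

count-+ : ∀ f a b → count f (a + b) ≡ count f a + count (λ i → f (a + i)) b
count-+ f zero    b = refl
count-+ f (suc a) b = trans (cong (bit (f 0) +_) (count-+ (f ∘ suc) a b))
  (sym (+-assoc (bit (f 0)) (count (f ∘ suc) a) _))

count-snoc : ∀ f n → count f (suc n) ≡ count f n + bit (f n)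
count-snoc f zero    = +-identityʳ (bit (f 0))
count-snoc f (suc n) = trans (cong (bit (f 0) +_) (count-snoc (f ∘ suc) n))
  (sym (+-assoc (bit (f 0)) (count (f ∘ suc) n) _))

-- Writing the reflection as `suc (i + j) ≡ n` avoids truncated subtraction and matches the triangle
-- coordinates. The induction takes `f` from the front and `g` from the back.
count-reverse : ∀ {f g} n → (∀ i j → suc (i + j) ≡ n → f i ≡ g j) → count f n ≡ count g n
count-reverse zero e = refl
count-reverse {f} {g} (suc n) e = begin
  bit (f 0) + count (f ∘ suc) n  ≡⟨ cong₂ _+_ (cong bit (e 0 n refl)) (count-reverse n λ i j eq → e (suc i) j (cong suc eq)) ⟩
  bit (g n) + count g n          ≡⟨ +-comm (bit (g n)) (count g n) ⟩
  count g n + bit (g n)          ≡⟨ count-snoc g n ⟨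
  count g (suc n)                ∎
  where open ≡-Reasoning

count-palindrome : ∀ {f} n → (∀ i j → suc (i + j) ≡ n + n → f i ≡ f j) →
                   count f (n + n) ≡ count f n + count f n
count-palindrome {f} n e = trans (count-+ f n n)
  (cong (count f n +_) (sym (count-reverse n λ i j eq → e i (n + j)
    (trans (regroup i j n) (cong (n +_) eq)))))
  where
  regroup : ∀ i j n → suc (i + (n + j)) ≡ n + suc (i + j)
  regroup = solve-∀

count≡0 : ∀ f n → count f n ≡ 0 → ∀ i → i < n → f i ≡ false
count≡0 f (suc n) e zero    _ with f 0
... | false = refl
count≡0 f (suc n) e (suc i) (s≤s i<n) = count≡0 (f ∘ suc) n (m+n≡0⇒n≡0 (bit (f 0)) e) i i<n

odd-+ : ∀ a b → odd (a + b) ≡ odd a xor odd b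
odd-+ zero    b = refl
odd-+ (suc a) b = trans (cong not (odd-+ a b)) (sym (xor-assoc true (odd a) (odd b)))

odd-bit : ∀ b → odd (bit b) ≡ b
odd-bit false = refl
odd-bit true  = refl

xor-cancel : ∀ a b c → (a xor b) xor (b xor c) ≡ a xor c
xor-cancel false false c = refl
xor-cancel false true  false = refl
xor-cancel false true  true = refl
xor-cancel true  false c = refl
xor-cancel true  true  c = refl

-- With `g` one row and `f` the next, the local rule makes the parity of an initial segment of `f`
-- depend on two entries of `g` only.
odd-count-telescope : ∀ {f} g n → (∀ i → i < n → f i ≡ g i xor g (suc i)) →
                      odd (count f n) ≡ g 0 xor g n
odd-count-telescope g zero e = sym (xor-same (g 0))
odd-count-telescope {f} g (suc n) e = begin
  odd (bit (f 0) + count (f ∘ suc) n)          ≡⟨ odd-+ (bit (f 0)) _ ⟩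
  odd (bit (f 0)) xor odd (count (f ∘ suc) n)  ≡⟨ cong₂ _xor_ (trans (odd-bit (f 0)) (e 0 (s≤s z≤n)))
                                                   (odd-count-telescope (g ∘ suc) n λ i i<n → e (suc i) (s≤s i<n)) ⟩
  (g 0 xor g 1) xor (g 1 xor g (suc n))        ≡⟨ xor-cancel (g 0) (g 1) (g (suc n)) ⟩
  g 0 xor g (suc n)                            ∎
  where open ≡-Reasoning

odd-double : ∀ n → odd (n + n) ≡ false
odd-double n = trans (odd-+ n n) (xor-same (odd n))

-- Each even-position value of `f` occurs twice in `g`, except the first and the last, which occur
-- once; adding these two ends doubles the whole count of `f`.
count-doubling : ∀ {f g} n → (∀ i → i < n → g (i + i) ≡ f (i + i)) →
                 (∀ i → i < n → g (suc (i + i)) ≡ f (suc (suc (i + i)))) →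
                 (∀ i → i < n → f (suc (i + i)) ≡ false) →
                 count g (n + n) + (bit (f 0) + bit (f (n + n))) ≡
                 count f (suc (n + n)) + count f (suc (n + n))
count-doubling {f} zero e o z = regroup (bit (f 0))
  where
  regroup : ∀ x → x + x ≡ x + 0 + (x + 0)
  regroup = solve-∀
count-doubling {f} {g} (suc n) e o z rewrite +-suc n n = begin
  bit (g 0) + (bit (g 1) + count g₂ (n + n)) + (bit (f 0) + bit (f₂ (n + n)))
    ≡⟨ cong₂ (λ x y → bit x + (bit y + count g₂ (n + n)) + (bit (f 0) + bit (f₂ (n + n))))
         (e 0 (s≤s z≤n)) (o 0 (s≤s z≤n)) ⟩
  bit (f 0) + (bit (f 2) + count g₂ (n + n)) + (bit (f 0) + bit (f₂ (n + n)))
    ≡⟨ rearrange₁ (bit (f 0)) (bit (f 2)) (count g₂ (n + n)) (bit (f₂ (n + n))) ⟩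
  bit (f 0) + bit (f 0) + (count g₂ (n + n) + (bit (f 2) + bit (f₂ (n + n))))
    ≡⟨ cong (bit (f 0) + bit (f 0) +_) (count-doubling {f₂} {g₂} n (shift₂ (λ j → g j ≡ f j) e)
         (shift₂ (λ j → g (suc j) ≡ f (suc (suc j))) o) (shift₂ (λ j → f (suc j) ≡ false) z)) ⟩
  bit (f 0) + bit (f 0) + (count f₂ (suc (n + n)) + count f₂ (suc (n + n)))
    ≡⟨ rearrange₂ (bit (f 0)) (count f₂ (suc (n + n))) ⟩
  bit (f 0) + (0 + count f₂ (suc (n + n))) + (bit (f 0) + (0 + count f₂ (suc (n + n))))
    ≡⟨ cong (λ x → bit (f 0) + (bit x + count f₂ (suc (n + n))) + (bit (f 0) + (bit x + count f₂ (suc (n + n)))))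
         (z 0 (s≤s z≤n)) ⟨
  count f (suc (suc (suc (n + n)))) + count f (suc (suc (suc (n + n)))) ∎
  where
  open ≡-Reasoning
  f₂ g₂ : ℕ → Bool
  f₂ i = f (suc (suc i))
  g₂ i = g (suc (suc i))
  shift₂ : (P : ℕ → Set) → (∀ i → i < suc n → P (i + i)) → ∀ i → i < n → P (suc (suc (i + i)))
  shift₂ P p i i<n = subst (P ∘ suc) (+-suc i i) (p (suc i) (s≤s i<n))
  rearrange₁ : ∀ a b c d → a + (b + c) + (a + d) ≡ a + a + (c + (b + d))
  rearrange₁ = solve-∀
  rearrange₂ : ∀ a c → a + a + (c + c) ≡ a + (0 + c) + (a + (0 + c))
  rearrange₂ = solve-∀

-- Triangles with the symmetries of a multi-symmetric matrix.

+-swapʳ : ∀ r s t → r + s + t ≡ r + t + s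
+-swapʳ = solve-∀

+-reverse : ∀ t s r → t + s + r ≡ r + t + s
+-reverse = solve-∀

+-double : ∀ a b → (a + b) + (a + b) ≡ (a + a) + (b + b)
+-double = solve-∀

split-double : ∀ a b → a + a + suc (suc (b + b)) ≡ suc (a + b) + suc (a + b)
split-double = solve-∀

-- Entries have barycentric coordinates (r , t , s): row r, position t, and s
-- further entries in the row, so that suc (r + t + s) ≡ m.
record SymmetricTriangle (m : ℕ) (T : ℕ → ℕ → Bool) : Set where
  field
    rule       : ∀ r t → suc (r + t) < m → T (suc r) t ≡ T r t xor T r (suc t)
    palindrome : ∀ r t s → suc (r + t + s) ≡ m → T r t ≡ T r s
    antidiag   : ∀ r t s → suc (r + t + s) ≡ m → T r t ≡ T s t

  -- Conjugating the swap of `r` and `s` by the swap of `t` and `s` gives the swap of `r` and `t`.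
  transpose : ∀ r t s → suc (r + t + s) ≡ m → T r t ≡ T t r
  transpose r t s e = begin
    T r t ≡⟨ palindrome r t s e ⟩
    T r s ≡⟨ antidiag r s t (trans (cong suc (+-swapʳ r s t)) e) ⟩
    T t s ≡⟨ palindrome t s r (trans (cong suc (+-reverse t s r)) e) ⟩
    T t r ∎
    where
    open ≡-Reasoning

count-double : ∀ {m T} → SymmetricTriangle m T → ∀ r q → r + (q + q) ≡ m →
               count (T r) (q + q) ≡ count (T r) q + count (T r) q
count-double S r q e = count-palindrome q λ i j eq → palindrome r i j
  (trans (cong suc (+-assoc r i j)) (trans (sym (+-suc r (i + j))) (trans (cong (r +_) eq) e)))
  where open SymmetricTriangle S

-- The half row telescopes to the first and middle entries of row `suc r`. That middle entry is the
-- sum of the two central entries of row `r`, which are equal by the palindrome, so it vanishes.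
odd-half-row : ∀ {m T} → SymmetricTriangle m T → ∀ r q → suc (suc (r + (q + q))) ≡ m →
               odd (count (T (suc (suc r))) q) ≡ T (suc r) 0
odd-half-row {m} {T} S r q e = begin
  odd (count (T (suc (suc r))) q)           ≡⟨ odd-count-telescope (T (suc r)) q (λ i i<q → rule (suc r) i (bound i i<q)) ⟩
  T (suc r) 0 xor T (suc r) q               ≡⟨ cong (T (suc r) 0 xor_) (rule r q middle<m) ⟩
  T (suc r) 0 xor (T r q xor T r (suc q))   ≡⟨ cong (λ b → T (suc r) 0 xor (b xor T r (suc q))) (palindrome r q (suc q) middle) ⟩
  T (suc r) 0 xor (T r (suc q) xor T r (suc q)) ≡⟨ cong (T (suc r) 0 xor_) (xor-same (T r (suc q))) ⟩
  T (suc r) 0 xor false                     ≡⟨ xor-identityʳ _ ⟩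
  T (suc r) 0                               ∎
  where
  open ≡-Reasoning
  open SymmetricTriangle S
  bound : ∀ i → i < q → suc (suc r + i) < m
  bound i i<q = subst (suc (suc (r + i)) <_) e
    (s≤s (s≤s (+-monoʳ-< r (<-≤-trans i<q (m≤m+n q q)))))
  middle : suc (r + q + suc q) ≡ m
  middle = trans (cong suc (trans (+-suc (r + q) q) (cong suc (+-assoc r q q)))) e
  middle<m : suc (r + q) < m
  middle<m = subst (suc (r + q) <_) middle (s≤s (m<m+n (r + q) (s≤s z≤n)))

-- Parity of half the common degree.

module Regular {k T d} (S : SymmetricTriangle (suc (suc (k + k))) T)
  (regular : ∀ p q → p + q ≡ suc (suc (k + k)) → count (T p) q + count (T q) p ≡ d) where

  open SymmetricTriangle S
  open ≡-Reasoning

  even-row : ∀ r q → suc (suc r) + suc (suc (q + q)) ≡ suc (suc (k + k)) →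
             count (T (suc (suc r))) (suc (suc (q + q))) ≡
             count (T (suc (suc r))) (suc q) + count (T (suc (suc r))) (suc q)
  even-row r q e = trans (cong (count (T (suc (suc r)))) (cong suc (sym (+-suc q q))))
    (count-double S (suc (suc r)) (suc q) (trans (cong (suc (suc r) +_) (cong suc (+-suc q q))) e))

  -- Both rows meeting at vertex 2p + 2 are palindromes of even length, so half the
  -- degree is a sum of two half rows.
  odd-half-degree : ∀ p q → suc (suc (p + p)) + suc (suc (q + q)) ≡ suc (suc (k + k)) →
                    odd ⌊ d /2⌋ ≡ T 1 (suc (p + p))
  odd-half-degree p q e = begin
    odd ⌊ d /2⌋                ≡⟨ cong (λ n → odd ⌊ n /2⌋) d≡ ⟩
    odd ⌊ (h + h′) + (h + h′) /2⌋ ≡⟨ cong odd (n≡⌊n+n/2⌋ (h + h′)) ⟨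
    odd (h + h′)               ≡⟨ odd-+ h h′ ⟩
    odd h xor odd h′           ≡⟨ cong₂ _xor_ (odd-half-row S (p + p) (suc q) e₁) (odd-half-row S (q + q) (suc p) e₂) ⟩
    -- The symmetries carry these two entries to the adjacent positions `2p + 1` and `2p + 2` of row
    -- 0, where the local rule adds them.
    T (suc (p + p)) 0 xor T (suc (q + q)) 0
      ≡⟨ cong₂ _xor_ (transpose (suc (p + p)) 0 (suc (suc (q + q))) e₃)
           (trans (antidiag (suc (q + q)) 0 (suc (suc (p + p))) e₄)
             (transpose (suc (suc (p + p))) 0 (suc (q + q)) e₅)) ⟩
    T 0 (suc (p + p)) xor T 0 (suc (suc (p + p))) ≡⟨ rule 0 (suc (p + p)) bound ⟨
    T 1 (suc (p + p))          ∎
    where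
    h h′ : ℕ
    h  = count (T (suc (suc (p + p)))) (suc q)
    h′ = count (T (suc (suc (q + q)))) (suc p)
    e′ : suc (suc (q + q)) + suc (suc (p + p)) ≡ suc (suc (k + k))
    e′ = trans (+-comm (suc (suc (q + q))) _) e
    d≡ : d ≡ (h + h′) + (h + h′)
    d≡ = begin
      d                     ≡⟨ regular (suc (suc (p + p))) (suc (suc (q + q))) e ⟨
      _                     ≡⟨ cong₂ _+_ (even-row (p + p) q e) (even-row (q + q) p e′) ⟩
      (h + h) + (h′ + h′)   ≡⟨ +-double h h′ ⟨
      (h + h′) + (h + h′)   ∎
    e₁ : suc (suc (p + p + (suc q + suc q))) ≡ suc (suc (k + k))
    e₁ = trans (cong (λ n → suc (suc (p + p + suc n))) (+-suc q q)) e
    e₂ : suc (suc (q + q + (suc p + suc p))) ≡ suc (suc (k + k))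
    e₂ = trans (cong (λ n → suc (suc (q + q + suc n))) (+-suc p p)) e′
    e₃ : suc (suc (p + p) + 0 + suc (suc (q + q))) ≡ suc (suc (k + k))
    e₃ = trans (cong (λ n → suc (suc (n + suc (suc (q + q))))) (+-identityʳ (p + p))) e
    e₄ : suc (suc (q + q) + 0 + suc (suc (p + p))) ≡ suc (suc (k + k))
    e₄ = trans (cong (λ n → suc (suc (n + suc (suc (p + p))))) (+-identityʳ (q + q))) e′
    e₅ : suc (suc (suc (p + p)) + 0 + suc (q + q)) ≡ suc (suc (k + k))
    e₅ = trans (cong (λ n → suc (suc (suc (n + suc (q + q))))) (+-identityʳ (p + p)))
           (trans (cong (λ n → suc (suc n)) (sym (+-suc (p + p) (suc (q + q))))) e)
    bound : suc (suc (p + p)) < suc (suc (k + k))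
    bound = subst (suc (suc (p + p)) <_) e (m<m+n (suc (suc (p + p))) (s≤s z≤n))

  -- Taking `q = k - 1 - i` makes `2i + 2` and `2q + 2` opposite vertices, so every odd position of
  -- row 1 is reached and all these entries agree.
  odd-entry : ∀ i → i < k → odd ⌊ d /2⌋ ≡ T 1 (suc (i + i))
  odd-entry i i<k with m≤n⇒∃[o]m+o≡n i<k
  ... | q , e = odd-half-degree i q (cong (λ n → suc (suc n)) (trans (split-double i q) (cong₂ _+_ e e)))

-- For `k ≥ 2`, two applications of the rule write `T 3 1` as `T 1 1 xor T 1 3`, a sum of equal
-- entries, and `transpose` identifies `T 3 1` with `T 1 3`. For `k = 1`, row 1 has no position 3,
-- and the central pair of row 0 is used instead.
T₁₁≡false : ∀ k {T d} → SymmetricTriangle (suc (suc (k + k))) T →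
            (∀ i → i < k → odd ⌊ d /2⌋ ≡ T 1 (suc (i + i))) → 0 < k → T 1 1 ≡ false
T₁₁≡false 1 {T} S _ _ = begin
  T 1 1            ≡⟨ rule 0 1 (s≤s (s≤s (s≤s z≤n))) ⟩
  T 0 1 xor T 0 2  ≡⟨ cong (_xor T 0 2) (palindrome 0 1 2 refl) ⟩
  T 0 2 xor T 0 2  ≡⟨ xor-same (T 0 2) ⟩
  false            ∎
  where
  open ≡-Reasoning
  open SymmetricTriangle S
T₁₁≡false (suc (suc l)) {T} {d} S odd-entry _ = begin
  T 1 1            ≡⟨ T₁₁≡T₁₃ ⟩
  T 1 3            ≡⟨ transpose 1 3 (suc (l + l)) e ⟩
  T 3 1            ≡⟨ rule 2 1 (below 2 ≤-refl) ⟩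
  T 2 1 xor T 2 2  ≡⟨ cong₂ _xor_ (rule 1 1 (below 1 (s≤s z≤n))) (rule 1 2 (below 2 ≤-refl)) ⟩
  (T 1 1 xor T 1 2) xor (T 1 2 xor T 1 3) ≡⟨ xor-cancel (T 1 1) (T 1 2) (T 1 3) ⟩
  T 1 1 xor T 1 3  ≡⟨ cong (_xor T 1 3) T₁₁≡T₁₃ ⟩
  T 1 3 xor T 1 3  ≡⟨ xor-same (T 1 3) ⟩
  false            ∎
  where
  open ≡-Reasoning
  open SymmetricTriangle S
  m≡ : 6 + (l + l) ≡ suc (suc (suc (suc l) + suc (suc l)))
  m≡ = cong (4 +_) (trans (cong suc (sym (+-suc l l))) (sym (+-suc l (suc l))))
  e : suc (1 + 3 + suc (l + l)) ≡ suc (suc (suc (suc l) + suc (suc l)))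
  e = m≡
  below : ∀ j → j ≤ 2 → suc (suc j) < suc (suc (suc (suc l) + suc (suc l)))
  below j j≤ = subst (suc (suc j) <_) m≡ (s≤s (s≤s (s≤s (≤-trans j≤ (s≤s (s≤s z≤n))))))
  T₁₁≡T₁₃ : T 1 1 ≡ T 1 3
  T₁₁≡T₁₃ = trans (sym (odd-entry 0 (s≤s z≤n))) (odd-entry 1 (s≤s (s≤s z≤n)))

-- Vanishing of the common degree and of the triangle.

m+m≡m⇒m≡0 : ∀ m → m + m ≡ m → m ≡ 0
m+m≡m⇒m≡0 m e = +-cancelˡ-≡ m m 0 (trans e (sym (+-identityʳ m)))

-- Here `a` and `b` stand for the counts of rows 1 and 2, and `x₀`, `x₁` for `T 0 0`, `T 0 1`. If
-- `x₀` is false, then `d = a` and the equations give `a + a = a`. If it is true, then `b = a`,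
-- which leaves `d = 3` or `d = 1`, both odd.
common-degree≡0 : ∀ x₀ x₁ {a b d} → a + bit x₀ ≡ d → b + (bit (x₀ xor x₁) + bit x₁) ≡ d →
      b + (bit (x₀ xor x₁) + bit (x₀ xor x₁)) ≡ a + a → odd d ≡ false → d ≡ 0
common-degree≡0 false false {a} {b} refl q r _ rewrite +-identityʳ a | +-identityʳ b = m+m≡m⇒m≡0 a (trans (sym r) q)
common-degree≡0 false true  {a} {b} refl q r _ rewrite +-identityʳ a = m+m≡m⇒m≡0 a (trans (sym r) q)
common-degree≡0 true  false {a} {b} refl q r o rewrite +-cancelʳ-≡ 1 b a q with +-cancelˡ-≡ a 2 a r
... | refl = contradiction o λ ()
common-degree≡0 true  true  {a} {b} refl q r o rewrite +-cancelʳ-≡ 1 b a q | +-identityʳ a with m+m≡m⇒m≡0 a (sym r)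
... | refl = contradiction o λ ()

triangle≡0 : ∀ k {T d} → SymmetricTriangle (suc (suc (k + k))) T →
             (∀ p q → p + q ≡ suc (suc (k + k)) → count (T p) q + count (T q) p ≡ d) →
             ∀ r t → r + t < suc (suc (k + k)) → T r t ≡ false
triangle≡0 k {T} {d} S regular = rows
  where
  open SymmetricTriangle S
  open ≡-Reasoning
  m : ℕ
  m = suc (suc (k + k))
  odd-entries≡0 : ∀ i → i < k → T 1 (suc (i + i)) ≡ false
  odd-entries≡0 i i<k = trans (sym (odd-entry i i<k))
    (trans (odd-entry 0 0<k) (T₁₁≡false k {d = d} S odd-entry 0<k))
    where
    open Regular {k} S regular
    -- For `k = 0` row 1 has no odd position; otherwise the given `i < k` provides positivity.
    0<k : 0 < k
    0<k = ≤-trans (s≤s z≤n) i<k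

  double< : ∀ i → i < k → suc (i + i) < k + k
  double< i i<k = subst (_≤ k + k) (cong suc (+-suc i i)) (+-mono-≤ i<k i<k)

  T₂-even : ∀ i → i < k → T 2 (i + i) ≡ T 1 (i + i)
  T₂-even i i<k = begin
    T 2 (i + i)                       ≡⟨ rule 1 (i + i) (s≤s (s≤s (<-trans (n<1+n _) (double< i i<k)))) ⟩
    T 1 (i + i) xor T 1 (suc (i + i)) ≡⟨ cong (T 1 (i + i) xor_) (odd-entries≡0 i i<k) ⟩
    T 1 (i + i) xor false             ≡⟨ xor-identityʳ _ ⟩
    T 1 (i + i)                       ∎

  T₂-odd : ∀ i → i < k → T 2 (suc (i + i)) ≡ T 1 (suc (suc (i + i)))
  T₂-odd i i<k = begin
    T 2 (suc (i + i))                             ≡⟨ rule 1 (suc (i + i)) (s≤s (s≤s (double< i i<k))) ⟩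
    T 1 (suc (i + i)) xor T 1 (suc (suc (i + i))) ≡⟨ cong (_xor T 1 (suc (suc (i + i)))) (odd-entries≡0 i i<k) ⟩
    T 1 (suc (suc (i + i)))                       ∎

  T₁₀ : T 1 0 ≡ T 0 0 xor T 0 1
  T₁₀ = rule 0 0 (s≤s (s≤s z≤n))

  -- The row opposite vertex 1 has one entry and the row opposite vertex 2 has two; `antidiag` moves
  -- them to the top of the triangle.
  degree₁ : count (T 1) (suc (k + k)) + bit (T 0 0) ≡ d
  degree₁ = begin
    count (T 1) (suc (k + k)) + bit (T 0 0)
      ≡⟨ cong (λ b → count (T 1) (suc (k + k)) + bit b) (antidiag 0 0 (suc (k + k)) refl) ⟩
    count (T 1) (suc (k + k)) + bit (T (suc (k + k)) 0)
      ≡⟨ cong (count (T 1) (suc (k + k)) +_) (+-identityʳ _) ⟨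
    count (T 1) (suc (k + k)) + count (T (suc (k + k))) 1
      ≡⟨ regular 1 (suc (k + k)) refl ⟩
    d ∎

  degree₂ : count (T 2) (k + k) + (bit (T 0 0 xor T 0 1) + bit (T 0 1)) ≡ d
  degree₂ = begin
    count (T 2) (k + k) + (bit (T 0 0 xor T 0 1) + bit (T 0 1))
      ≡⟨ cong₂ (λ b c → count (T 2) (k + k) + (bit b + bit c))
           (trans (sym T₁₀) (antidiag 1 0 (k + k) refl)) (antidiag 0 1 (k + k) refl) ⟩
    count (T 2) (k + k) + (bit (T (k + k) 0) + bit (T (k + k) 1))
      ≡⟨ cong (λ n → count (T 2) (k + k) + (bit (T (k + k) 0) + n)) (+-identityʳ _) ⟨
    count (T 2) (k + k) + count (T (k + k)) 2
      ≡⟨ regular 2 (k + k) refl ⟩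
    d ∎

  -- The two end corrections of `count-doubling` coincide, since row 1 is a palindrome; both equal
  -- `T 1 0`.
  row₂ : count (T 2) (k + k) + (bit (T 0 0 xor T 0 1) + bit (T 0 0 xor T 0 1)) ≡
         count (T 1) (suc (k + k)) + count (T 1) (suc (k + k))
  row₂ = begin
    count (T 2) (k + k) + (bit (T 0 0 xor T 0 1) + bit (T 0 0 xor T 0 1))
      ≡⟨ cong₂ (λ b c → count (T 2) (k + k) + (bit b + bit c))
           (sym T₁₀) (trans (sym T₁₀) (palindrome 1 0 (k + k) refl)) ⟩
    count (T 2) (k + k) + (bit (T 1 0) + bit (T 1 (k + k)))
      ≡⟨ count-doubling {T 1} {T 2} k T₂-even T₂-odd odd-entries≡0 ⟩
    count (T 1) (suc (k + k)) + count (T 1) (suc (k + k)) ∎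

  degree₀ : count (T 0) m ≡ d
  degree₀ = trans (sym (+-identityʳ _)) (regular 0 m refl)

  odd-d : odd d ≡ false
  odd-d = begin
    odd d                       ≡⟨ cong odd degree₀ ⟨
    odd (count (T 0) m)         ≡⟨ cong (odd ∘ count (T 0) ∘ suc) (+-suc k k) ⟨
    odd (count (T 0) (suc k + suc k)) ≡⟨ cong odd (count-double S 0 (suc k) (cong suc (+-suc k k))) ⟩
    odd (count (T 0) (suc k) + count (T 0) (suc k)) ≡⟨ odd-double (count (T 0) (suc k)) ⟩
    false                       ∎

  rows : ∀ r t → r + t < m → T r t ≡ false
  rows zero t t<m = count≡0 (T 0) m
    (trans degree₀ (common-degree≡0 (T 0 0) (T 0 1) {b = count (T 2) (k + k)} degree₁ degree₂ row₂ odd-d)) t t<m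
  rows (suc r) t lt = begin
    T (suc r) t             ≡⟨ rule r t lt ⟩
    T r t xor T r (suc t)   ≡⟨ cong₂ _xor_ (rows r t (<-trans (n<1+n _) lt))
                                 (rows r (suc t) (subst (_< m) (sym (+-suc r t)) lt)) ⟩
    false                   ∎

-- From matrices to triangles.

entry-toℕ : ∀ {n} (M : Matrix n) i j → entry M (toℕ i) (toℕ j) ≡ M i j
entry-toℕ {n} M i j with toℕ i <? n | toℕ j <? n
... | yes i<n | yes j<n = cong₂ M (fromℕ<-toℕ i i<n) (fromℕ<-toℕ j j<n)
... | no i≮n  | _       = contradiction (toℕ<n i) i≮n
... | yes _   | no j≮n  = contradiction (toℕ<n j) j≮n

entry-fromℕ< : ∀ {n} (M : Matrix n) {i j} (i<n : i < n) (j<n : j < n) →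
               entry M i j ≡ M (fromℕ< i<n) (fromℕ< j<n)
entry-fromℕ< M i<n j<n = trans (sym (cong₂ (entry M) (toℕ-fromℕ< i<n) (toℕ-fromℕ< j<n)))
  (entry-toℕ M (fromℕ< i<n) (fromℕ< j<n))

-- `allFin` is `tabulate id`, whose tail tabulates `suc`; the induction therefore needs an arbitrary
-- `g`.
length-filter : ∀ {A : Set} {n} (P : A → Bool) (g : Fin n → A) f → (∀ j → P (g j) ≡ f (toℕ j)) →
                length (filter (λ x → P x ≟ true) (tabulate g)) ≡ count f n
length-filter {n = zero}  P g f e = refl
length-filter {n = suc n} P g f e with P (g zero) | e zero
... | false | e₀ rewrite sym e₀ = length-filter P (g ∘ suc) (f ∘ suc) (e ∘ suc)
... | true  | e₀ rewrite sym e₀ = cong suc (length-filter P (g ∘ suc) (f ∘ suc) (e ∘ suc))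

degree≡count : ∀ {n} (M : Matrix n) i → degree M i ≡ count (entry M (toℕ i)) n
degree≡count M i = length-filter (M i) id (entry M (toℕ i)) (λ j → sym (entry-toℕ M i j))

upper : ∀ {n} → Matrix n → ℕ → ℕ → Bool
upper M r t = entry M r (suc (r + t))

module _ {m} {M : Matrix (suc m)} (steinhaus : IsSteinhaus M) (multisymmetric : IsMultiSymmetric M) where

  open IsSteinhaus steinhaus
  open IsMultiSymmetric multisymmetric
  open IsDoublySymmetric doubly using (antisym)
  open ≡-Reasoning

  entry-sym : ∀ {i j} → i < suc m → j < suc m → entry M i j ≡ entry M j i
  entry-sym i<n j<n = begin
    _ ≡⟨ entry-fromℕ< M i<n j<n ⟩
    _ ≡⟨ symmetric (fromℕ< i<n) (fromℕ< j<n) ⟩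
    _ ≡⟨ entry-fromℕ< M j<n i<n ⟨
    _ ∎

  entry-diag : ∀ {i} → i < suc m → entry M i i ≡ false
  entry-diag i<n = trans (entry-fromℕ< M i<n i<n) (diag-zero (fromℕ< i<n))

  -- Matching on `refl` sets `m = r + t + s + 1`. Then `multi` sends column `r + t + 1` to
  -- `r + s + 1`, and `antisym` sends the index pair `(r, r + t + 1)` to `(s, s + t + 1)`.
  triangle : SymmetricTriangle m (upper M)
  triangle = record
    { rule = λ r t lt → trans (local-rule r (suc (suc (r + t))) (s≤s (s≤s (m≤m+n r t))) (s≤s lt))
        (cong (λ j → entry M r (suc (r + t)) xor entry M r (suc j)) (sym (+-suc r t)))
    ; palindrome = λ { r t s refl → trans (multi r (suc (r + t)) (s≤s (m≤m+n r t)) (s≤s (s≤s (m≤m+n (r + t) s))))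
        (cong (entry M r) (reflected r t s)) }
    ; antidiag = λ { r t s refl → trans (antisym r (suc (r + t))
          (s≤s (m≤n⇒m≤1+n (≤-trans (m≤m+n r t) (m≤m+n (r + t) s)))) (s≤s (s≤s (m≤m+n (r + t) s))))
        (cong₂ (entry M) (m+n∸m≡n (r + t) s) (reflected′ r t s)) }
    }
    where
    reflected : ∀ r t s → suc (r + t + s) ∸ (r + t) + r ≡ suc (r + s)
    reflected r t s = trans (cong (_+ r) (trans (cong (_∸ (r + t)) (sym (+-suc (r + t) s))) (m+n∸m≡n (r + t) (suc s))))
      (cong suc (+-comm s r))
    reflected′ : ∀ r t s → suc (r + t + s) ∸ r ≡ suc (s + t)
    reflected′ r t s = trans (cong (_∸ r) (trans (cong suc (+-assoc r t s)) (sym (+-suc r (t + s)))))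
      (trans (m+n∸m≡n r (suc (t + s))) (cong suc (+-comm t s)))

  open SymmetricTriangle triangle using (antidiag)

  -- The matrix row is cut at its zero diagonal entry. The part to the left, read away from the
  -- diagonal, is column `p` by symmetry and hence row `q` of the triangle by `antidiag`.
  degree-split : ∀ p q → p + q ≡ m → count (entry M p) (suc m) ≡ count (upper M q) p + count (upper M p) q
  degree-split p q refl = begin
    count (entry M p) (suc (p + q))  ≡⟨ cong (count (entry M p)) (+-suc p q) ⟨
    count (entry M p) (p + suc q)    ≡⟨ count-+ (entry M p) p (suc q) ⟩
    count (entry M p) p + (bit (entry M p (p + 0)) + count (λ t → entry M p (p + suc t)) q)
      ≡⟨ cong₂ _+_ (count-reverse p column)
           (cong₂ _+_ (cong bit (trans (cong (entry M p) (+-identityʳ p)) (entry-diag p<n)))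
             (count-cong q (λ t _ → cong (entry M p) (+-suc p t)))) ⟩
    count (upper M q) p + count (upper M p) q ∎
    where
    p<n : p < suc (p + q)
    p<n = s≤s (m≤m+n p q)
    column : ∀ i j → suc (i + j) ≡ p → entry M p i ≡ upper M q j
    column i j refl = trans (entry-sym p<n (s≤s (m≤n⇒m≤1+n (≤-trans (m≤m+n i j) (m≤m+n (i + j) q)))))
      (antidiag i j q refl)

  upper≡0⇒zero : (∀ r t → r + t < m → upper M r t ≡ false) → IsZero M
  upper≡0⇒zero z i j = trans (sym (entry-toℕ M i j)) (go (toℕ i) (toℕ j) (toℕ<n i) (toℕ<n j))
    where
    above : ∀ i j → i < j → j < suc m → entry M i j ≡ false
    above i j i<j (s≤s j≤m) with m≤n⇒∃[o]m+o≡n i<j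
    ... | t , refl = z i t j≤m
    go : ∀ i j → i < suc m → j < suc m → entry M i j ≡ false
    go i j i<n j<n with <-cmp i j
    ... | tri< i<j _ _  = above i j i<j j<n
    ... | tri≈ _ refl _ = entry-diag i<n
    ... | tri> _ _ j<i  = trans (entry-sym i<n j<n) (above j i j<i i<n)

  degrees-equal : IsRegular M → ∀ p q → p + q ≡ m →
                  count (upper M p) q + count (upper M q) p ≡ degree M zero
  degrees-equal regular p q e = begin
    count (upper M p) q + count (upper M q) p ≡⟨ +-comm (count (upper M p) q) _ ⟩
    count (upper M q) p + count (upper M p) q ≡⟨ degree-split p q e ⟨
    count (entry M p) (suc m)                 ≡⟨ cong (λ r → count (entry M r) (suc m)) (toℕ-fromℕ< p<n) ⟨
    count (entry M (toℕ (fromℕ< p<n))) (suc m) ≡⟨ degree≡count M (fromℕ< p<n) ⟨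
    degree M (fromℕ< p<n)                     ≡⟨ regular (fromℕ< p<n) zero ⟩
    degree M zero                             ∎
    where
    p<n : p < suc m
    p<n = s≤s (subst (p ≤_) e (m≤m+n p q))

theorem8 : ∀ (k : ℕ) (M : Matrix (suc (2 * k))) →
    IsSteinhaus M → IsMultiSymmetric M → IsRegular M → IsZero M
-- The single vertex is separate because the triangle argument needs `m = 2k + 2`.
theorem8 zero    M st ms reg zero zero = IsSteinhaus.diag-zero st zero
-- `2 * suc k` reduces to `suc (k + suc (k + 0))`, so `triangle≡0` is transported from
-- `suc (suc (k + k))`.
theorem8 (suc k) M st ms reg = upper≡0⇒zero st ms (subst
  (λ m → ∀ {T d} → SymmetricTriangle m T → (∀ p q → p + q ≡ m → count (T p) q + count (T q) p ≡ d) →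
         ∀ r t → r + t < m → T r t ≡ false)
  (cong suc (trans (sym (+-suc k k)) (cong (λ n → k + suc n) (sym (+-identityʳ k)))))
  (triangle≡0 k) (triangle st ms) (degrees-equal st ms reg))
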